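{- As formal power series in $x$, $D(-1;x)=F(x)^{ -1}$.
   Context: Let $\mathfrak{D}_n$ be the set of derangements of $[n]=\{1,\dots,n\}$, i.e. permutations $\pi=\pi_1\cdots\pi_n$ with $\pi_i\ne i$ for all $i$. An element $i\in[n]$ is an excedance of $\pi$ if $i<\pi_i$; let $\mathsf{exc}(\pi)$ be the number of excedances of $\pi$. Define $D_n(t)=\sum_{\pi\in\mathfrak{D}_n}t^{\mathsf{exc}(\pi)}$ and $D(t;x)=1+\sum_{n=1}^\infty D_n(t)\frac{x^n}{n!}$. Let $f_n=1$ if $n$ is even and $f_n=0$ if $n$ is odd ($n\ge0$), and $F(x)=\sum_{n\ge0}f_n\frac{x^n}{n!}=\cosh(x)$. -}

module Defs where

import Algebra.Definitions.RawSemiring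
open import Data.Bool.Base using (if_then_else_)
open import Data.Fin.Base using (Fin; zero; suc; toℕ; _<_)
open import Data.Fin.Properties using (_≟_; _<?_; all?; any?)
open import Data.Integer.Base using (1ℤ)
open import Data.List.Base using (List; []; _∷_; allFin; cartesianProductWith; filter; foldr; length; map)
open import Data.List.Membership.Propositional using (_∈_)
open import Data.List.Membership.Propositional.Properties
  using (∈-allFin; ∈-cartesianProductWith⁺; ∈-filter⁺; ∈-filter⁻)
import Data.List.Relation.Unary.All as All
import Data.List.Relation.Unary.AllPairs as AllPairs
open import Data.List.Relation.Unary.Any using (here)
open import Data.List.Relation.Unary.Unique.Propositional using (Unique)
import Data.List.Relation.Unary.Unique.Propositional.Properties as Unique
open import Data.Nat.Base as ℕ using (ℕ; zero; suc; _∸_; _!)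
open import Data.Nat.Divisibility using (_∣?_)
open import Data.Nat.Properties using (_!≢0)
open import Data.Product.Base using (_×_; _,_; proj₁; proj₂)
open import Data.Rational.Base
  using (ℚ; 0ℚ; 1ℚ; _+_; _*_; -_; _/_; 1/_; NonZero; +-*-rawSemiring)
open import Data.Rational.Properties
  using (+-identityʳ; +-inverseˡ; *-inverseʳ; *-identityˡ; *-assoc; neg-distribʳ-*)
open import Data.Vec.Base as Vec using (Vec; []; _∷_; lookup)
open import Data.Vec.Properties using (∷-injective)
open import Function.Base using (_∘_)
open import Function.Consequences.Propositional
  using (strictlySurjective⇒surjective; surjective⇒strictlySurjective)
open import Function.Definitions using (Bijective)
open import Relation.Binary.PropositionalEquality
  using (_≡_; _≢_; _≗_; refl; sym; trans; cong; cong₂; module ≡-Reasoning)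
open import Relation.Nullary.Decidable using (Dec; does; map′; ¬?; _×-dec_; _→-dec_)
open import Relation.Unary using (Decidable)

open Algebra.Definitions.RawSemiring +-*-rawSemiring using (_^_; sum)

-- One-line notation π₁⋯πₙ over [n], with Fin n (that is, {0,…,n-1}) in
-- place of {1,…,n}.
Word : ℕ → Set
Word n = Vec (Fin n) n

IsPermutation : ∀ {n} → Word n → Set
IsPermutation π = Bijective _≡_ _≡_ (lookup π)

IsDerangement : ∀ {n} → Word n → Set
IsDerangement π = IsPermutation π × (∀ i → lookup π i ≢ i)

isPermutation? : ∀ {n} → Decidable (IsPermutation {n})
isPermutation? π =
  map′ (λ f {i} {j} → f i j) (λ f i j → f {i} {j})
    (all? λ i → all? λ j → (lookup π i ≟ lookup π j) →-dec (i ≟ j))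
  ×-dec
  map′ strictlySurjective⇒surjective surjective⇒strictlySurjective
    (all? λ j → any? λ i → lookup π i ≟ j)

isDerangement? : ∀ {n} → Decidable (IsDerangement {n})
isDerangement? π = isPermutation? π ×-dec all? λ i → ¬? (lookup π i ≟ i)

vectors : ∀ n m → List (Vec (Fin n) m)
vectors n zero    = [] ∷ []
vectors n (suc m) = cartesianProductWith _∷_ (allFin n) (vectors n m)

𝔇 : ∀ n → List (Word n)
𝔇 n = filter isDerangement? (vectors n n)

-- 𝔇 n lists every derangement exactly once (∈-𝔇⁺, ∈-𝔇⁻, 𝔇-unique).

∈-vectors : ∀ {n m} (v : Vec (Fin n) m) → v ∈ vectors n m
∈-vectors []      = here refl
∈-vectors (i ∷ v) = ∈-cartesianProductWith⁺ _∷_ (∈-allFin i) (∈-vectors v)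

vectors-unique : ∀ n m → Unique (vectors n m)
vectors-unique n zero    = All.[] AllPairs.∷ AllPairs.[]
vectors-unique n (suc m) =
  Unique.cartesianProductWith⁺ _∷_ ∷-injective (Unique.allFin⁺ n) (vectors-unique n m)

∈-𝔇⁺ : ∀ {n} {π : Word n} → IsDerangement π → π ∈ 𝔇 n
∈-𝔇⁺ {π = π} = ∈-filter⁺ isDerangement? (∈-vectors π)

∈-𝔇⁻ : ∀ {n} {π : Word n} → π ∈ 𝔇 n → IsDerangement π
∈-𝔇⁻ {n} = proj₂ ∘ ∈-filter⁻ isDerangement? {xs = vectors n n}

𝔇-unique : ∀ n → Unique (𝔇 n)
𝔇-unique n = Unique.filter⁺ isDerangement? (vectors-unique n n)

exc : ∀ {n} → Word n → ℕ
exc {n} π = length (filter (λ i → i <? lookup π i) (allFin n))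

Dₙ : ℕ → ℚ → ℚ
Dₙ n t = foldr _+_ 0ℚ (map (λ π → t ^ exc π) (𝔇 n))

-- Formal power series in x over ℚ, as sequences of coefficients.
PowerSeries : Set
PowerSeries = ℕ → ℚ

infix 4 _≈_
_≈_ : PowerSeries → PowerSeries → Set
_≈_ = _≗_

one : PowerSeries
one zero    = 1ℚ
one (suc _) = 0ℚ

infixl 7 _⊛_
_⊛_ : PowerSeries → PowerSeries → PowerSeries
(a ⊛ b) n = sum {suc n} λ k → a (toℕ k) * b (n ∸ toℕ k)

-- The first n + 1 coefficients of the inverse of a, highest degree first,
-- computed from  a₀ bₙ₊₁ = - ∑_{k ≤ n} aₖ₊₁ bₙ₋ₖ.
inverseCoefficients : (a : PowerSeries) .{{_ : NonZero (a 0)}} → ∀ n → Vec ℚ (suc n)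
inverseCoefficients a zero    = 1/ a 0 ∷ []
inverseCoefficients a (suc n) =
  - (1/ a 0 * sum (λ k → a (suc (toℕ k)) * lookup bs k)) ∷ bs
  where bs = inverseCoefficients a n

infix 8 _⁻¹
_⁻¹ : (a : PowerSeries) .{{_ : NonZero (a 0)}} → PowerSeries
(a ⁻¹) n = Vec.head (inverseCoefficients a n)

lookup-inverseCoefficients : ∀ (a : PowerSeries) .{{_ : NonZero (a 0)}} n (k : Fin (suc n)) →
                             lookup (inverseCoefficients a n) k ≡ (a ⁻¹) (n ∸ toℕ k)
lookup-inverseCoefficients a zero    zero    = refl
lookup-inverseCoefficients a (suc n) zero    = refl
lookup-inverseCoefficients a (suc n) (suc k) = lookup-inverseCoefficients a n k

private
  sum-cong : ∀ {n} {f g : Fin n → ℚ} → f ≗ g → sum f ≡ sum g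
  sum-cong {zero}  f≗g = refl
  sum-cong {suc n} f≗g = cong₂ _+_ (f≗g zero) (sum-cong (f≗g ∘ suc))

⊛-inverseʳ : ∀ (a : PowerSeries) .{{_ : NonZero (a 0)}} → a ⊛ a ⁻¹ ≈ one
⊛-inverseʳ a zero    = trans (+-identityʳ _) (*-inverseʳ (a 0))
⊛-inverseʳ a (suc n) = begin
  a 0 * - (1/ a 0 * s) + s′  ≡⟨ cong (_+ s′) (sym (neg-distribʳ-* (a 0) _)) ⟩
  - (a 0 * (1/ a 0 * s)) + s′ ≡⟨ cong (λ p → - p + s′) (sym (*-assoc (a 0) _ s)) ⟩
  - (a 0 * 1/ a 0 * s) + s′  ≡⟨ cong (λ p → - (p * s) + s′) (*-inverseʳ (a 0)) ⟩
  - (1ℚ * s) + s′            ≡⟨ cong₂ (λ p q → - p + q) (*-identityˡ s) (sym s≡s′) ⟩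
  - s + s                    ≡⟨ +-inverseˡ s ⟩
  0ℚ                         ∎
  where
  open ≡-Reasoning
  s  = sum λ (k : Fin (suc n)) → a (suc (toℕ k)) * lookup (inverseCoefficients a n) k
  s′ = sum λ (k : Fin (suc n)) → a (suc (toℕ k)) * (a ⁻¹) (n ∸ toℕ k)
  s≡s′ : s ≡ s′
  s≡s′ = sum-cong λ k → cong (a (suc (toℕ k)) *_) (lookup-inverseCoefficients a n k)

egf : (ℕ → ℚ) → PowerSeries
egf c n = c n * (1ℤ / n !) {{n !≢0}}

-- D t is D(t;x), whose constant term is prescribed to be 1.
D : ℚ → PowerSeries
D t zero      = 1ℚ
D t n@(suc _) = egf (λ m → Dₙ m t) n

f : ℕ → ℚ
f n = if does (2 ∣? n) then 1ℚ else 0ℚ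

F : PowerSeries
F = egf f

{-# OPTIONS --safe #-}

-- Dₙ(t) is the permanent of the n × n matrix with t above the diagonal, 1 below it and 0
-- on it. With diagonal y instead, splitting off the diagonal entries one at a time gives
-- Pₙ(y) = ∑ₖ C(n,k) yᵏ Dₙ₋ₖ(t). A cyclic rotation of the rows shows Pₙ(t) = t Pₙ(1) for
-- n ≥ 1, so at t = -1 the sum Pₙ(1) + Pₙ(-1) = 2 ∑ₖ C(n,k) fₖ Dₙ₋ₖ(-1) vanishes: this is
-- F(x) D(-1;x) = 1.
module Submission where

open import Algebra.Bundles using (CommutativeRing)
import Algebra.Definitions.RawSemiring
import Algebra.Properties.Group as GroupProperties
import Algebra.Properties.Monoid.Mult as MonoidMult
import Algebra.Properties.Semiring.Mult as SemiringMult
import Algebra.Properties.Semiring.Sum as SemiringSum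
open import Data.Bool.Base using (true; false; if_then_else_)
open import Data.Fin.Base using (Fin; zero; suc; toℕ; fromℕ; fromℕ<; punchIn; punchOut)
open import Data.Fin.Properties
  using (_≟_; _<?_; any?; toℕ<n; toℕ-fromℕ<; suc-injective; punchIn-injective; punchInᵢ≢i;
         punchOut-injective; injective⇒≤)
open import Data.Integer.Base as ℤ using (1ℤ)
import Data.Integer.Properties as ℤ
open import Data.List.Base
  using (List; []; _∷_; _++_; cartesianProductWith; filter; foldr; length; map; tabulate)
open import Data.Nat.Base as ℕ using (ℕ; zero; suc; _∸_; _!; z≤n; s≤s)
open import Data.Nat.Combinatorics using (_C_; nCk+nC[k+1]≡[n+1]C[k+1]; nCk≡n!/k![n-k]!; k![n∸k]!∣n!)
open import Data.Nat.Divisibility using (_∣?_; ∣m+n∣m⇒∣n; ∣m∣n⇒∣m+n; ∣-refl)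
open import Data.Nat.Induction using (<-rec)
open import Data.Nat.DivMod using (m/n*n≡m)
import Data.Nat.Properties as ℕ
open import Data.Product.Base using (_,_)
open import Data.Rational.Base
  using (ℚ; 0ℚ; 1ℚ; ½; _+_; _*_; -_; _/_; 1/_; NonZero; toℚᵘ; +-*-rawSemiring)
import Data.Rational.Properties as ℚ
open import Data.Rational.Solver using (module +-*-Solver)
open import Data.Rational.Unnormalised.Base as ℚᵘ using (mkℚᵘ; *≡*)
import Data.Rational.Unnormalised.Properties as ℚᵘ
open import Data.Vec.Base using (Vec; []; _∷_; lookup)
import Data.Vec.Functional as Vector
open import Function.Base using (_∘_; const)
open import Function.Bundles using (mk⇔)
open import Function.Consequences.Propositional using (strictlySurjective⇒surjective)
open import Function.Definitions using (Injective; StrictlySurjective)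
open import Relation.Binary.PropositionalEquality
  using (_≡_; _≢_; refl; sym; trans; cong; cong₂; subst; module ≡-Reasoning)
open import Relation.Nullary using (¬_; does; yes; no; contradiction)
open import Relation.Nullary.Decidable using (decidable-stable; does-⇔; dec-true; dec-false)
open import Relation.Unary using (Decidable)
open import Defs

open Algebra.Definitions.RawSemiring +-*-rawSemiring using (_^_; sum)
open CommutativeRing ℚ.+-*-commutativeRing using (semiring; +-group; +-monoid)
open SemiringSum semiring
  using (sum-cong-≗; sum-remove; ∑-distrib-+; ∑-comm; *-distribˡ-sum; sum-replicate-zero)
open SemiringMult semiring using (_×_; ×1-homo-*)
open MonoidMult +-monoid using (×-homo-+)
open ≡-Reasoning
open +-*-Solver using (solve; _:=_; _:+_; _:*_; con)

private
  variable
    m n : ℕ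
    A B X : Set

-- Permanents

Matrix : ℕ → ℕ → Set
Matrix m n = Fin m → Fin n → ℚ

eraseColumn : Fin n → Matrix m n → Matrix m n
eraseColumn j M i k = if does (k ≟ j) then 0ℚ else M i k

-- Expansion along the first row, over injections Fin m → Fin n. Used columns are
-- zeroed rather than removed, so that removals of different columns commute.
per : Matrix m n → ℚ
per {zero}  M = 1ℚ
per {suc m} M = sum λ j → M zero j * per (eraseColumn j (M ∘ suc))

eraseColumn-eq : ∀ (M : Matrix m n) i j → eraseColumn j M i j ≡ 0ℚ
eraseColumn-eq M i j rewrite dec-true (j ≟ j) refl = refl

eraseColumn-neq : ∀ (M : Matrix m n) i {j k} → k ≢ j → eraseColumn j M i k ≡ M i k
eraseColumn-neq M i {j} {k} k≢j rewrite dec-false (k ≟ j) k≢j = refl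

eraseColumn-zero : ∀ (M : Matrix m n) i {j k} → M i k ≡ 0ℚ → eraseColumn j M i k ≡ 0ℚ
eraseColumn-zero M i {j} {k} eq with does (k ≟ j)
... | true  = refl
... | false = eq

eraseColumn-cong : ∀ {M N : Matrix m n} j → (∀ i k → M i k ≡ N i k) →
                   ∀ i k → eraseColumn j M i k ≡ eraseColumn j N i k
eraseColumn-cong j M≡N i k = cong (if does (k ≟ j) then 0ℚ else_) (M≡N i k)

eraseColumn-comm : ∀ (M : Matrix m n) j k i l →
                   eraseColumn j (eraseColumn k M) i l ≡ eraseColumn k (eraseColumn j M) i l
eraseColumn-comm M j k i l with does (l ≟ j) | does (l ≟ k)
... | true  | true  = refl
... | true  | false = refl
... | false | true  = refl
... | false | false = refl

eraseColumn-punchIn : ∀ (M : Matrix m (suc n)) j k i l →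
                      eraseColumn (punchIn j k) M i (punchIn j l) ≡
                      eraseColumn k (λ i′ l′ → M i′ (punchIn j l′)) i l
eraseColumn-punchIn M j k i l =
  cong (if_then 0ℚ else M i (punchIn j l))
    (does-⇔ (mk⇔ (punchIn-injective j l k) (cong (punchIn j))) (punchIn j l ≟ punchIn j k) (l ≟ k))

p≡0⇒p*q≡0 : ∀ {p} q → p ≡ 0ℚ → p * q ≡ 0ℚ
p≡0⇒p*q≡0 q refl = ℚ.*-zeroˡ q

q≡0⇒p*q≡0 : ∀ p {q} → q ≡ 0ℚ → p * q ≡ 0ℚ
q≡0⇒p*q≡0 p refl = ℚ.*-zeroʳ p

per-cong : {M N : Matrix m n} → (∀ i j → M i j ≡ N i j) → per M ≡ per N
per-cong {zero}  M≡N = refl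
per-cong {suc m} M≡N = sum-cong-≗ λ j →
  cong₂ _*_ (M≡N zero j) (per-cong (eraseColumn-cong j (M≡N ∘ suc)))

-- By induction on `i`: expand along the first row, expand each minor along row `i`, swap the two
-- sums, and read the result as the expansions taken in the opposite order.
per-laplace : ∀ (M : Matrix (suc m) n) i →
              per M ≡ sum λ k → M i k * per (eraseColumn k (M ∘ punchIn i))
per-laplace M zero = refl
per-laplace {suc m} {n} M (suc i) = begin
  sum (λ j → M zero j * per (eraseColumn j (M ∘ suc)))
    ≡⟨ sum-cong-≗ (λ j → cong (M zero j *_) (per-laplace (eraseColumn j (M ∘ suc)) i)) ⟩
  sum (λ j → M zero j * sum λ k → eraseColumn j (M ∘ suc) i k * minor j k)
    ≡⟨ sum-cong-≗ (λ j → *-distribˡ-sum (M zero j)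
         λ k → eraseColumn j (M ∘ suc) i k * minor j k) ⟩
  sum (λ j → sum λ k → M zero j * (eraseColumn j (M ∘ suc) i k * minor j k))
    ≡⟨ ∑-comm (λ j k → M zero j * (eraseColumn j (M ∘ suc) i k * minor j k)) ⟩
  sum (λ k → sum λ j → M zero j * (eraseColumn j (M ∘ suc) i k * minor j k))
    ≡⟨ sum-cong-≗ (λ k → sum-cong-≗ (λ j → exchange j k)) ⟩
  sum (λ k → sum λ j → M (suc i) k * (eraseColumn k (M ∘ punchIn (suc i)) zero j * minor′ j k))
    ≡⟨ sum-cong-≗ (λ k → sym (*-distribˡ-sum (M (suc i) k)
         λ j → eraseColumn k (M ∘ punchIn (suc i)) zero j * minor′ j k)) ⟩
  sum (λ k → M (suc i) k * per (eraseColumn k (M ∘ punchIn (suc i)))) ∎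
  where
  N : Matrix m n
  N = M ∘ suc ∘ punchIn i
  minor minor′ : Fin n → Fin n → ℚ
  minor  j k = per (eraseColumn k (eraseColumn j N))
  minor′ j k = per (eraseColumn j (eraseColumn k N))
  exchange : ∀ j k → M zero j * (eraseColumn j (M ∘ suc) i k * minor j k) ≡
                     M (suc i) k * (eraseColumn k (M ∘ punchIn (suc i)) zero j * minor′ j k)
  exchange j k with j ≟ k
  -- Two rows using the same column: both sides contain an entry of an erased column, hence are 0.
  ... | yes refl rewrite dec-true (j ≟ j) refl =
    solve 3 (λ x y z → x :* (con 0ℚ :* z) := y :* (con 0ℚ :* z)) refl (M zero j) (M (suc i) j) (minor j j)
  ... | no j≢k rewrite dec-false (k ≟ j) (j≢k ∘ sym)
                     | per-cong (eraseColumn-comm N j k) =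
    solve 3 (λ x y z → x :* (y :* z) := y :* (x :* z)) refl (M zero j) (M (suc i) k) (minor j k)

-- Turns erased columns back into genuine minors. In the first-row expansion the summand of column
-- `j` vanishes; in each of the others the two erasures commute, and the induction applies to the
-- rows below.
per-eraseColumn : ∀ (M : Matrix m (suc n)) j →
                  per (eraseColumn j M) ≡ per (λ i k → M i (punchIn j k))
per-eraseColumn {zero}  M j = refl
per-eraseColumn {suc m} M j = begin
  sum term                                   ≡⟨ sum-remove {i = j} term ⟩
  term j + sum (term ∘ punchIn j)            ≡⟨ cong₂ _+_ vanishes (sum-cong-≗ reduce) ⟩
  0ℚ + per (λ i k → M i (punchIn j k))       ≡⟨ ℚ.+-identityˡ _ ⟩
  per (λ i k → M i (punchIn j k))            ∎
  where
  term : Fin _ → ℚ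
  term k = eraseColumn j M zero k * per (eraseColumn k (eraseColumn j (M ∘ suc)))
  vanishes : term j ≡ 0ℚ
  vanishes = p≡0⇒p*q≡0 _ (eraseColumn-eq M zero j)
  reduce : ∀ k → term (punchIn j k) ≡
                 M zero (punchIn j k) * per (eraseColumn k (λ i l → M (suc i) (punchIn j l)))
  reduce k = cong₂ _*_ (eraseColumn-neq M zero (punchInᵢ≢i j k)) (begin
    per (eraseColumn (punchIn j k) (eraseColumn j (M ∘ suc)))
      ≡⟨ per-cong (eraseColumn-comm (M ∘ suc) (punchIn j k) j) ⟩
    per (eraseColumn j (eraseColumn (punchIn j k) (M ∘ suc)))
      ≡⟨ per-eraseColumn (eraseColumn (punchIn j k) (M ∘ suc)) j ⟩
    per (λ i l → eraseColumn (punchIn j k) (M ∘ suc) i (punchIn j l))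
      ≡⟨ per-cong (eraseColumn-punchIn (M ∘ suc) j k) ⟩
    per (eraseColumn k (λ i l → M (suc i) (punchIn j l))) ∎)

-- Linearity in row `i`: that row of `M` is the same row of `N` plus a single entry in column `j`,
-- and the two matrices share all cofactors of the row.
per-splitEntry : ∀ (M N : Matrix (suc m) (suc n)) i j →
                 (∀ k l → M (punchIn i k) l ≡ N (punchIn i k) l) →
                 (∀ l → M i (punchIn j l) ≡ N i (punchIn j l)) →
                 N i j ≡ 0ℚ →
                 per M ≡ M i j * per (λ k l → M (punchIn i k) (punchIn j l)) + per N
per-splitEntry M N i j rows row entry = begin
  per M
    ≡⟨ per-laplace M i ⟩
  sum (λ l → M i l * cofactor l)
    ≡⟨ sum-remove {i = j} (λ l → M i l * cofactor l) ⟩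
  M i j * cofactor j + sum (λ l → M i (punchIn j l) * cofactor (punchIn j l))
    ≡⟨ cong₂ (λ p q → M i j * p + q) (per-eraseColumn (M ∘ punchIn i) j)
         (sum-cong-≗ λ l → cong (_* cofactor (punchIn j l)) (row l)) ⟩
  lead + rest
    -- The inserted 0 becomes the missing summand of `N` at column `j`, completing `rest` to a sum
    -- over all columns.
    ≡⟨ cong (lead +_) (sym (ℚ.+-identityˡ rest)) ⟩
  lead + (0ℚ + rest)
    ≡⟨ cong (λ p → lead + (p + rest))
         (sym (p≡0⇒p*q≡0 (cofactor j) entry)) ⟩
  lead + (N i j * cofactor j + rest)
    ≡⟨ cong (lead +_) (sym (sum-remove {i = j} (λ l → N i l * cofactor l))) ⟩
  lead + sum (λ l → N i l * cofactor l)
    ≡⟨ cong (lead +_)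
         (sum-cong-≗ λ l → cong (N i l *_) (per-cong (eraseColumn-cong l rows))) ⟩
  lead + sum (λ l → N i l * per (eraseColumn l (N ∘ punchIn i)))
    ≡⟨ cong (lead +_) (sym (per-laplace N i)) ⟩
  lead + per N ∎
  where
  cofactor : Fin _ → ℚ
  cofactor l = per (eraseColumn l (M ∘ punchIn i))
  minor lead rest : ℚ
  minor = per (λ k l → M (punchIn i k) (punchIn j l))
  lead  = M i j * minor
  rest  = sum λ l → N i (punchIn j l) * cofactor (punchIn j l)

-- Permanents as sums over words

-- The contribution of one word to `per`: a repeated letter selects from an erased column, so only
-- injective words can contribute.
pick : Matrix m n → Vec (Fin n) m → ℚ
pick M []      = 1ℚ
pick M (j ∷ v) = M zero j * pick (eraseColumn j (M ∘ suc)) v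

product : (Fin n → ℚ) → ℚ
product = Vector.foldr _*_ 1ℚ

product-cong : {f g : Fin n → ℚ} → (∀ i → f i ≡ g i) → product f ≡ product g
product-cong {zero}  f≡g = refl
product-cong {suc n} f≡g = cong₂ _*_ (f≡g zero) (product-cong (f≡g ∘ suc))

pick≢0⇒entry≢0 : ∀ (M : Matrix m n) v → pick M v ≢ 0ℚ → ∀ i → M i (lookup v i) ≢ 0ℚ
pick≢0⇒entry≢0 M (j ∷ v) ≢0 zero    eq = ≢0 (p≡0⇒p*q≡0 _ eq)
pick≢0⇒entry≢0 M (j ∷ v) ≢0 (suc i) eq =
  pick≢0⇒entry≢0 (eraseColumn j (M ∘ suc)) v
    (λ eq′ → ≢0 (q≡0⇒p*q≡0 (M zero j) eq′)) i
    (eraseColumn-zero (M ∘ suc) i eq)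

pick≢0⇒injective : ∀ (M : Matrix m n) v → pick M v ≢ 0ℚ → Injective _≡_ _≡_ (lookup v)
pick≢0⇒injective {suc m} {n} M (j ∷ v) ≢0 = injective
  where
  tail≢0 : pick (eraseColumn j (M ∘ suc)) v ≢ 0ℚ
  tail≢0 eq = ≢0 (q≡0⇒p*q≡0 (M zero j) eq)
  fresh : ∀ i → lookup v i ≢ j
  fresh i refl = pick≢0⇒entry≢0 _ v tail≢0 i (eraseColumn-eq (M ∘ suc) i (lookup v i))
  injective : Injective _≡_ _≡_ (lookup (j ∷ v))
  injective {zero}  {zero}  eq = refl
  injective {zero}  {suc b} eq = contradiction (sym eq) (fresh b)
  injective {suc a} {zero}  eq = contradiction eq (fresh a)
  injective {suc a} {suc b} eq = cong suc (pick≢0⇒injective _ v tail≢0 eq)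

-- Without repeated letters no entry is ever taken from an erased column, so the erasures leave the
-- product unchanged.
pick-injective : ∀ (M : Matrix m n) v → Injective _≡_ _≡_ (lookup v) →
                 pick M v ≡ product λ i → M i (lookup v i)
pick-injective M []      inj = refl
pick-injective M (j ∷ v) inj = cong (M zero j *_) (begin
  pick (eraseColumn j (M ∘ suc)) v
    ≡⟨ pick-injective _ v (suc-injective ∘ inj) ⟩
  product (λ i → eraseColumn j (M ∘ suc) i (lookup v i))
    ≡⟨ product-cong (λ i → eraseColumn-neq (M ∘ suc) i λ eq →
         contradiction (inj {zero} {suc i} (sym eq)) λ ()) ⟩
  product (λ i → M (suc i) (lookup v i)) ∎)

-- Sums over lists

total : (A → ℚ) → List A → ℚ
total g xs = foldr _+_ 0ℚ (map g xs)

total-cong : ∀ {g h : A → ℚ} → (∀ x → g x ≡ h x) → ∀ xs → total g xs ≡ total h xs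
total-cong g≡h []       = refl
total-cong g≡h (x ∷ xs) = cong₂ _+_ (g≡h x) (total-cong g≡h xs)

total-++ : ∀ (g : A → ℚ) xs ys → total g (xs ++ ys) ≡ total g xs + total g ys
total-++ g []       ys = sym (ℚ.+-identityˡ _)
total-++ g (x ∷ xs) ys = trans (cong (g x +_) (total-++ g xs ys)) (sym (ℚ.+-assoc (g x) _ _))

total-map : ∀ (g : A → ℚ) (h : B → A) xs → total g (map h xs) ≡ total (g ∘ h) xs
total-map g h []       = refl
total-map g h (x ∷ xs) = cong (λ s → g (h x) + s) (total-map g h xs)

*-distribˡ-total : ∀ c (g : A → ℚ) xs → total (λ x → c * g x) xs ≡ c * total g xs
*-distribˡ-total c g []       = sym (ℚ.*-zeroʳ c)
*-distribˡ-total c g (x ∷ xs) = 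
  trans (cong (λ s → c * g x + s) (*-distribˡ-total c g xs)) (sym (ℚ.*-distribˡ-+ c (g x) (total g xs)))

-- Used to extend the sum over derangements to all words, the other words having weight 0.
total-filter : ∀ {P : A → Set} (P? : Decidable P) {g h : A → ℚ} →
               (∀ {x} → P x → g x ≡ h x) → (∀ {x} → ¬ P x → h x ≡ 0ℚ) →
               ∀ xs → total g (filter P? xs) ≡ total h xs
total-filter P? eq vanish []       = refl
total-filter P? {g} {h} eq vanish (x ∷ xs) with P? x
... | yes Px = cong₂ _+_ (eq Px) (total-filter P? eq vanish xs)
... | no ¬Px = trans (total-filter P? eq vanish xs)
                 (trans (sym (ℚ.+-identityˡ _)) (cong (_+ total h xs) (sym (vanish ¬Px))))

-- A general `tabulate xs` lets the induction pass to `xs ∘ suc`; `allFin n` is the case of the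
-- identity.
total-cartesianProductWith : ∀ (g : A → ℚ) (c : B → X → A) (xs : Fin n → B) ys →
  total g (cartesianProductWith c (tabulate xs) ys) ≡ sum λ i → total (g ∘ c (xs i)) ys
total-cartesianProductWith {n = zero}  g c xs ys = refl
total-cartesianProductWith {n = suc n} g c xs ys = begin
  total g (map (c (xs zero)) ys ++ rest)
    ≡⟨ total-++ g (map (c (xs zero)) ys) rest ⟩
  total g (map (c (xs zero)) ys) + total g rest
    ≡⟨ cong₂ _+_ (total-map g (c (xs zero)) ys) (total-cartesianProductWith g c (xs ∘ suc) ys) ⟩
  total (g ∘ c (xs zero)) ys + sum (λ i → total (g ∘ c (xs (suc i))) ys) ∎
  where
  rest = cartesianProductWith c (tabulate (xs ∘ suc)) ys

total-pick : ∀ (M : Matrix m n) → total (pick M) (vectors n m) ≡ per M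
total-pick {zero}      M = ℚ.+-identityʳ 1ℚ
total-pick {suc m} {n} M = begin
  total (pick M) (vectors n (suc m))
    ≡⟨ total-cartesianProductWith (pick M) _∷_ (λ j → j) (vectors n m) ⟩
  sum (λ j → total (λ v → M zero j * pick (eraseColumn j (M ∘ suc)) v) (vectors n m))
    ≡⟨ sum-cong-≗ (λ j → trans (*-distribˡ-total (M zero j) _ (vectors n m))
                           (cong (M zero j *_) (total-pick (eraseColumn j (M ∘ suc))))) ⟩
  per M ∎

-- Derangements

-- Pigeonhole: punching out a missed value `j` would inject `Fin (suc n)` into `Fin n`.
injective⇒surjective : ∀ {f : Fin n → Fin n} → Injective _≡_ _≡_ f → StrictlySurjective _≡_ f
injective⇒surjective {suc n} {f} inj j = decidable-stable (any? λ i → f i ≟ j) λ missed →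
  let j≢f : ∀ i → j ≢ f i
      j≢f i eq = missed (i , sym eq)
  in ℕ.1+n≰n (injective⇒≤ {f = λ i → punchOut (j≢f i)} λ {a} {b} eq →
       inj (punchOut-injective (j≢f a) (j≢f b) eq))

-- The diagonal is an arbitrary function because its entries are changed one at a time. Recursion on
-- both indices, instead of comparing them, suits the row and minor identities below.
excMatrix : ℚ → (Fin n → ℚ) → Matrix n n
excMatrix t d zero    zero    = d zero
excMatrix t d zero    (suc j) = t
excMatrix t d (suc i) zero    = 1ℚ
excMatrix t d (suc i) (suc j) = excMatrix t (d ∘ suc) i j

module _ (t : ℚ) where

  excMatrix-diagonal : ∀ (d : Fin n → ℚ) i → excMatrix t d i i ≡ d i
  excMatrix-diagonal d zero    = refl
  excMatrix-diagonal d (suc i) = excMatrix-diagonal (d ∘ suc) i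

  excMatrix-offDiagonal : ∀ (d : Fin n → ℚ) i j → j ≢ i →
                          excMatrix t d i j ≡ (if does (i <? j) then t else 1ℚ)
  excMatrix-offDiagonal d zero    zero    j≢i = contradiction refl j≢i
  excMatrix-offDiagonal d zero    (suc j) j≢i = refl
  excMatrix-offDiagonal d (suc i) zero    j≢i = refl
  excMatrix-offDiagonal d (suc i) (suc j) j≢i = excMatrix-offDiagonal (d ∘ suc) i j (j≢i ∘ cong suc)

  -- Row `i` meets the diagonal only at `d i`.
  excMatrix-row-cong : ∀ (d e : Fin n → ℚ) i j → d i ≡ e i → excMatrix t d i j ≡ excMatrix t e i j
  excMatrix-row-cong d e zero    zero    eq = eq
  excMatrix-row-cong d e zero    (suc j) eq = refl
  excMatrix-row-cong d e (suc i) zero    eq = refl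
  excMatrix-row-cong d e (suc i) (suc j) eq = excMatrix-row-cong (d ∘ suc) (e ∘ suc) i j eq

  -- Deleting a row and the column of the same index preserves the order of the remaining indices,
  -- hence which entries lie above or below the diagonal.
  excMatrix-minor : ∀ (d : Fin (suc n) → ℚ) i k l →
                    excMatrix t d (punchIn i k) (punchIn i l) ≡ excMatrix t (d ∘ punchIn i) k l
  excMatrix-minor d zero    k       l       = refl
  excMatrix-minor d (suc i) zero    zero    = refl
  excMatrix-minor d (suc i) zero    (suc l) = refl
  excMatrix-minor d (suc i) (suc k) zero    = refl
  excMatrix-minor d (suc i) (suc k) (suc l) = excMatrix-minor (d ∘ suc) i k l

  excMatrix-lastRow : ∀ n j → excMatrix t (const 1ℚ) (fromℕ n) j ≡ 1ℚ
  excMatrix-lastRow zero    zero    = refl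
  excMatrix-lastRow (suc n) zero    = refl
  excMatrix-lastRow (suc n) (suc j) = excMatrix-lastRow n j

  excMatrix-firstRow : ∀ (j : Fin (suc n)) → excMatrix t (const t) zero j ≡ t
  excMatrix-firstRow zero    = refl
  excMatrix-firstRow (suc j) = refl

  -- Both rows are 1 in the columns up to and including `k` and `t` afterwards; `punchIn (fromℕ n)`
  -- embeds `k` with its value unchanged.
  excMatrix-shiftRow : ∀ (k : Fin n) j →
    excMatrix t (const t) (suc k) j ≡ excMatrix t (const 1ℚ) (punchIn (fromℕ n) k) j
  excMatrix-shiftRow zero    zero    = refl
  excMatrix-shiftRow zero    (suc j) = excMatrix-firstRow j
  excMatrix-shiftRow (suc k) zero    = refl
  excMatrix-shiftRow (suc k) (suc j) = excMatrix-shiftRow k j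

  -- Moving the last row of the matrix with diagonal 1, all of whose entries are 1,
  -- to the top and multiplying it by t gives the matrix with diagonal t.
  per-excMatrix-rotate : ∀ n →
    per {suc n} (excMatrix t (const t)) ≡ t * per {suc n} (excMatrix t (const 1ℚ))
  per-excMatrix-rotate n = begin
    sum (λ j → Mₜ zero j * per (eraseColumn j (Mₜ ∘ suc)))
      ≡⟨ sum-cong-≗ (λ j → cong₂ _*_
           (trans (excMatrix-firstRow j)
             (trans (sym (ℚ.*-identityʳ t)) (cong (t *_) (sym (excMatrix-lastRow n j)))))
           (per-cong (eraseColumn-cong j excMatrix-shiftRow))) ⟩
    sum (λ j → t * M₁ (fromℕ n) j * minor j)
      ≡⟨ sum-cong-≗ (λ j → ℚ.*-assoc t (M₁ (fromℕ n) j) (minor j)) ⟩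
    sum (λ j → t * (M₁ (fromℕ n) j * minor j))
      ≡⟨ sym (*-distribˡ-sum t λ j → M₁ (fromℕ n) j * minor j) ⟩
    t * sum (λ j → M₁ (fromℕ n) j * minor j)
      ≡⟨ cong (t *_) (sym (per-laplace M₁ (fromℕ n))) ⟩
    t * per M₁ ∎
    where
    Mₜ M₁ : Matrix (suc n) (suc n)
    Mₜ = excMatrix t (const t)
    M₁ = excMatrix t (const 1ℚ)
    minor : Fin (suc n) → ℚ
    minor j = per (eraseColumn j (M₁ ∘ punchIn (fromℕ n)))

  ^-length-filter : ∀ {P : A → Set} (P? : Decidable P) (g : Fin n → A) →
    t ^ length (filter P? (tabulate g)) ≡ product λ i → if does (P? (g i)) then t else 1ℚ
  ^-length-filter {n = zero}  P? g = refl
  ^-length-filter {n = suc n} P? g with does (P? (g zero))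
  ... | true  = cong (t *_) (^-length-filter P? (g ∘ suc))
  ... | false = trans (^-length-filter P? (g ∘ suc)) (sym (ℚ.*-identityˡ _))

  -- A derangement selects only off-diagonal entries: `t` at each excedance and 1 elsewhere.
  pick-derangement : ∀ (d : Fin n → ℚ) {π} → IsDerangement π → t ^ exc π ≡ pick (excMatrix t d) π
  pick-derangement d {π} ((inj , _) , fixfree) = begin
    t ^ exc π
      ≡⟨ ^-length-filter (λ i → i <? lookup π i) (λ i → i) ⟩
    product (λ i → if does (i <? lookup π i) then t else 1ℚ)
      ≡⟨ product-cong (λ i → sym (excMatrix-offDiagonal d i (lookup π i) (fixfree i))) ⟩
    product (λ i → excMatrix t d i (lookup π i))
      ≡⟨ sym (pick-injective (excMatrix t d) π inj) ⟩
    pick (excMatrix t d) π ∎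

  -- By contraposition: a nonzero weight forces injectivity, hence bijectivity by finiteness, and
  -- the zero diagonal excludes fixed points.
  pick-nonderangement : ∀ {π : Word n} → ¬ IsDerangement π → pick (excMatrix t (const 0ℚ)) π ≡ 0ℚ
  pick-nonderangement {n} {π} ¬der = decidable-stable (_ ℚ.≟ 0ℚ) λ ≢0 →
    let inj = pick≢0⇒injective M π ≢0
    in ¬der ((inj , strictlySurjective⇒surjective (injective⇒surjective inj)) , λ i πᵢ≡i →
         pick≢0⇒entry≢0 M π ≢0 i (trans (cong (M i) πᵢ≡i) (excMatrix-diagonal (const 0ℚ) i)))
    where
    M : Matrix n n
    M = excMatrix t (const 0ℚ)

  Dₙ-permanent : ∀ n → Dₙ n t ≡ per {n} (excMatrix t (const 0ℚ))
  Dₙ-permanent n = trans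
    (total-filter isDerangement?
      (λ {π} → pick-derangement (const 0ℚ) {π}) (λ {π} → pick-nonderangement {π = π}) (vectors n n))
    (total-pick {n} {n} (excMatrix t (const 0ℚ)))

-- Binomial expansion in the diagonal

-- Diagonals interpolating between the zero diagonal and the constant diagonal `y`.
prefix : ℚ → ℕ → Fin n → ℚ
prefix y zero    i       = 0ℚ
prefix y (suc a) zero    = y
prefix y (suc a) (suc i) = prefix y a i

prefix-full : ∀ y (i : Fin n) → prefix y n i ≡ y
prefix-full y zero    = refl
prefix-full y (suc i) = prefix-full y i

prefix-last : ∀ y (i : Fin n) → prefix y (suc (toℕ i)) i ≡ y
prefix-last y zero    = refl
prefix-last y (suc i) = prefix-last y i

prefix-end : ∀ y (i : Fin n) → prefix y (toℕ i) i ≡ 0ℚ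
prefix-end y zero    = refl
prefix-end y (suc i) = prefix-end y i

prefix-off-end : ∀ y (i : Fin (suc n)) k →
                 prefix y (suc (toℕ i)) (punchIn i k) ≡ prefix y (toℕ i) (punchIn i k)
prefix-off-end y zero    k       = refl
prefix-off-end y (suc i) zero    = refl
prefix-off-end y (suc i) (suc k) = prefix-off-end y i k

prefix-punchIn : ∀ y (i : Fin (suc n)) k →
                 prefix y (suc (toℕ i)) (punchIn i k) ≡ prefix y (toℕ i) k
prefix-punchIn y zero    k       = refl
prefix-punchIn y (suc i) zero    = refl
prefix-punchIn y (suc i) (suc k) = prefix-punchIn y i k

module _ (t y : ℚ) where

  private
    E : ℕ → ℕ → ℚ
    E n a = per {n} (excMatrix t (prefix y a))

    d : ℕ → ℚ
    d n = per {n} (excMatrix t (const 0ℚ))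

    term : ℕ → ℕ → ℕ → ℚ
    term a n k = (a C k) × 1ℚ * y ^ k * d (n ∸ k)

  -- Splits off the last `y` on the diagonal: its minor keeps the other `a` copies, and replacing it
  -- by 0 shortens the prefix.
  E-pascal : ∀ {n a} → a ℕ.≤ n → E (suc n) (suc a) ≡ y * E n a + E (suc n) a
  E-pascal {n} {a} a≤n =
    -- The prefix lemmas speak of `toℕ i`, so `a` is first presented in that form.
    subst (λ a → E (suc n) (suc a) ≡ y * E n a + E (suc n) a) (toℕ-fromℕ< (s≤s a≤n)) (begin
    E (suc n) (suc (toℕ i))
      ≡⟨ per-splitEntry M N i i
           (λ k l → excMatrix-row-cong t _ _ (punchIn i k) l (prefix-off-end y i k))
           (λ l → trans (excMatrix-offDiagonal t _ i (punchIn i l) (punchInᵢ≢i i l))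
                    (sym (excMatrix-offDiagonal t _ i (punchIn i l) (punchInᵢ≢i i l))))
           (trans (excMatrix-diagonal t _ i) (prefix-end y i)) ⟩
    M i i * per (λ k l → M (punchIn i k) (punchIn i l)) + E (suc n) (toℕ i)
      ≡⟨ cong₂ (λ p q → p * q + E (suc n) (toℕ i))
           (trans (excMatrix-diagonal t _ i) (prefix-last y i))
           (per-cong λ k l → trans (excMatrix-minor t _ i k l)
             (excMatrix-row-cong t _ _ k l (prefix-punchIn y i k))) ⟩
    y * E n (toℕ i) + E (suc n) (toℕ i) ∎)
    where
    i : Fin (suc n)
    i = fromℕ< (s≤s a≤n)
    M N : Matrix (suc n) (suc n)
    M = excMatrix t (prefix y (suc (toℕ i)))
    N = excMatrix t (prefix y (toℕ i))

  -- Induction by Pascal's rule. The sum runs to `n` rather than `a`, the extra binomials being 0,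
  -- so that the two induction hypotheses align once the first term of the longer sum is set aside.
  E-binomial : ∀ {n a} → a ℕ.≤ n → E n a ≡ sum {suc n} λ k → term a n (toℕ k)
  E-binomial {n} {zero} _ = begin
    d n
      -- The factor `1 + 0` is what `(0 C 0) × 1ℚ` computes to.
      ≡⟨ solve 1 (λ x → x := (con 1ℚ :+ con 0ℚ) :* con 1ℚ :* x :+ con 0ℚ) refl (d n) ⟩
    term 0 n 0 + 0ℚ
      ≡⟨ cong (λ s → term 0 n 0 + s) (sym (trans (sum-cong-≗ vanish) (sum-replicate-zero n))) ⟩
    term 0 n 0 + sum {n} (λ k → term 0 n (suc (toℕ k))) ∎
    where
    vanish : ∀ (k : Fin n) → term 0 n (suc (toℕ k)) ≡ 0ℚ
    vanish k = solve 2 (λ p q → con 0ℚ :* p :* q := con 0ℚ) refl (y ^ suc (toℕ k)) (d (n ∸ suc (toℕ k)))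
  E-binomial {suc n} {suc a} (s≤s a≤n) = begin
    E (suc n) (suc a)
      ≡⟨ E-pascal a≤n ⟩
    y * E n a + E (suc n) a
      ≡⟨ cong₂ (λ p q → y * p + q) (E-binomial a≤n) (E-binomial (ℕ.m≤n⇒m≤1+n a≤n)) ⟩
    y * sum left + (term a (suc n) 0 + sum right)
      ≡⟨ solve 4 (λ y p q r → y :* p :+ (q :+ r) := q :+ (y :* p :+ r)) refl
           y (sum left) (term a (suc n) 0) (sum right) ⟩
    term a (suc n) 0 + (y * sum left + sum right)
      ≡⟨ cong (λ s → term a (suc n) 0 + (s + sum right)) (*-distribˡ-sum y left) ⟩
    term a (suc n) 0 + (sum (λ k → y * left k) + sum right)
      ≡⟨ cong (λ s → term a (suc n) 0 + s) (sym (∑-distrib-+ (λ k → y * left k) right)) ⟩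
    term a (suc n) 0 + sum (λ k → y * left k + right k)
      ≡⟨ cong (λ s → term a (suc n) 0 + s) (sum-cong-≗ {suc n} λ k → pascal (toℕ k)) ⟩
    sum {suc (suc n)} (λ k → term (suc a) (suc n) (toℕ k)) ∎
    where
    left right : Fin (suc n) → ℚ
    left  k = term a n (toℕ k)
    right k = term a (suc n) (suc (toℕ k))
    pascal : ∀ k → y * term a n k + term a (suc n) (suc k) ≡ term (suc a) (suc n) (suc k)
    pascal k = begin
      y * term a n k + term a (suc n) (suc k)
        -- Both terms share the factor `d (n ∸ k)`, because `suc n ∸ suc k` reduces to `n ∸ k`.
        ≡⟨ solve 5 (λ y p q c c′ → y :* (c :* p :* q) :+ c′ :* (y :* p) :* q := (c :+ c′) :* (y :* p) :* q)
             refl y (y ^ k) (d (n ∸ k)) ((a C k) × 1ℚ) ((a C suc k) × 1ℚ) ⟩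
      ((a C k) × 1ℚ + (a C suc k) × 1ℚ) * y ^ suc k * d (n ∸ k)
        ≡⟨ cong (λ c → c * y ^ suc k * d (n ∸ k))
             (trans (sym (×-homo-+ 1ℚ (a C k) (a C suc k)))
               (cong (_× 1ℚ) (nCk+nC[k+1]≡[n+1]C[k+1] a k))) ⟩
      term (suc a) (suc n) (suc k) ∎

per-excMatrix-binomial : ∀ t y n →
  per {n} (excMatrix t (const y)) ≡ sum {suc n} λ k → (n C toℕ k) × 1ℚ * y ^ toℕ k * Dₙ (n ∸ toℕ k) t
per-excMatrix-binomial t y n = begin
  per {n} {n} (excMatrix t (const y))
    ≡⟨ per-cong {n} {n} (λ i j → excMatrix-row-cong t _ _ i j (sym (prefix-full y i))) ⟩
  per {n} (excMatrix t (prefix y n))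
    ≡⟨ E-binomial t y {n} ℕ.≤-refl ⟩
  sum {suc n} (λ k → (n C toℕ k) × 1ℚ * y ^ toℕ k * per {n ∸ toℕ k} (excMatrix t (const 0ℚ)))
    ≡⟨ sum-cong-≗ {suc n} (λ k →
         cong (λ p → (n C toℕ k) × 1ℚ * y ^ toℕ k * p) (sym (Dₙ-permanent t (n ∸ toℕ k)))) ⟩
  sum {suc n} (λ k → (n C toℕ k) × 1ℚ * y ^ toℕ k * Dₙ (n ∸ toℕ k) t) ∎

-- Reciprocals of factorials

toℚᵘ-×1 : ∀ n → toℚᵘ (n × 1ℚ) ℚᵘ.≃ mkℚᵘ (ℤ.+ n) 0
toℚᵘ-×1 zero    = ℚᵘ.≃-refl
toℚᵘ-×1 (suc n) = ℚᵘ.≃-trans (ℚ.toℚᵘ-homo-+ 1ℚ (n × 1ℚ))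
  (ℚᵘ.≃-trans (ℚᵘ.+-congʳ (toℚᵘ 1ℚ) (toℚᵘ-×1 n))
    (*≡* (cong (λ p → (1ℤ ℤ.+ p) ℤ.* 1ℤ) (ℤ.*-identityʳ (ℤ.+ n)))))

-- Checked on unnormalised fractions, where equality is cross-multiplication and no gcd intervenes.
×1-*-reciprocal : ∀ n .{{_ : ℕ.NonZero n}} → n × 1ℚ * (1ℤ / n) ≡ 1ℚ
×1-*-reciprocal n@(suc n-1) =
  ℚ.toℚᵘ-injective (ℚᵘ.≃-trans (ℚ.toℚᵘ-homo-* (n × 1ℚ) (1ℤ / n))
  (ℚᵘ.≃-trans (ℚᵘ.*-cong (toℚᵘ-×1 n) (ℚ.toℚᵘ-fromℚᵘ (mkℚᵘ 1ℤ n-1)))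
    (*≡* (trans (ℤ.*-identityʳ _) (trans (ℤ.*-identityʳ (ℤ.+ n))
      (sym (trans (ℤ.*-identityˡ _) (cong (ℤ.+_) (ℕ.+-identityʳ n)))))))))

1/! : ℕ → ℚ
1/! n = (1ℤ / n !) {{n ℕ.!≢0}}

×1-!-inverseʳ : ∀ n → (n !) × 1ℚ * 1/! n ≡ 1ℚ
×1-!-inverseʳ n = ×1-*-reciprocal (n !) {{n ℕ.!≢0}}

C-*-1/! : ∀ {n k} → k ℕ.≤ n → (n C k) × 1ℚ * 1/! n ≡ 1/! k * 1/! (n ∸ k)
C-*-1/! {n} {k} k≤n = begin
  c * 1/! n
    ≡⟨ solve 2 (λ c r → c :* r := c :* r :* (con 1ℚ :* con 1ℚ)) refl c (1/! n) ⟩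
  c * 1/! n * (1ℚ * 1ℚ)
    -- Each 1 is written as a factorial times its reciprocal, so that the integer factors can be
    -- collected into `n !`.
    ≡⟨ cong₂ (λ x y → c * 1/! n * (x * y)) (sym (×1-!-inverseʳ k)) (sym (×1-!-inverseʳ (n ∸ k))) ⟩
  c * 1/! n * (p * 1/! k * (q * 1/! (n ∸ k)))
    ≡⟨ solve 6 (λ c r p x q y → c :* r :* (p :* x :* (q :* y)) := c :* (p :* q) :* r :* (x :* y)) refl
         c (1/! n) p (1/! k) q (1/! (n ∸ k)) ⟩
  c * (p * q) * 1/! n * (1/! k * 1/! (n ∸ k))
    ≡⟨ cong (λ x → c * x * 1/! n * (1/! k * 1/! (n ∸ k))) (sym (×1-homo-* (k !) ((n ∸ k) !))) ⟩
  c * ((k ! ℕ.* (n ∸ k) !) × 1ℚ) * 1/! n * (1/! k * 1/! (n ∸ k))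
    ≡⟨ cong (λ x → x * 1/! n * (1/! k * 1/! (n ∸ k))) (sym (×1-homo-* (n C k) (k ! ℕ.* (n ∸ k) !))) ⟩
  ((n C k) ℕ.* (k ! ℕ.* (n ∸ k) !)) × 1ℚ * 1/! n * (1/! k * 1/! (n ∸ k))
    ≡⟨ cong (λ x → x × 1ℚ * 1/! n * (1/! k * 1/! (n ∸ k))) C-*-! ⟩
  (n !) × 1ℚ * 1/! n * (1/! k * 1/! (n ∸ k))
    ≡⟨ cong (_* (1/! k * 1/! (n ∸ k))) (×1-!-inverseʳ n) ⟩
  1ℚ * (1/! k * 1/! (n ∸ k))
    ≡⟨ ℚ.*-identityˡ _ ⟩
  1/! k * 1/! (n ∸ k) ∎
  where
  c p q : ℚ
  c = (n C k) × 1ℚ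
  p = (k !) × 1ℚ
  q = ((n ∸ k) !) × 1ℚ
  C-*-! : (n C k) ℕ.* (k ! ℕ.* (n ∸ k) !) ≡ n !
  C-*-! = trans (cong (ℕ._* (k ! ℕ.* (n ∸ k) !)) (nCk≡n!/k![n-k]! k≤n))
            (m/n*n≡m {{k ℕ.!* (n ∸ k) !≢0}} (k![n∸k]!∣n! k≤n))

-- Power series

-- Strong induction: coefficient `n` of `a ⊛ b` is `a 0 * b n` plus a sum involving only earlier
-- coefficients of `b`.
⊛-cancelˡ : ∀ (a : PowerSeries) .{{_ : NonZero (a 0)}} {b c} → a ⊛ b ≈ a ⊛ c → b ≈ c
⊛-cancelˡ a {b} {c} ab≈ac = <-rec (λ n → b n ≡ c n) λ n rec → begin
  b n                      ≡⟨ unscale (b n) ⟩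
  1/ a 0 * (a 0 * b n)     ≡⟨ cong (1/ a 0 *_) (∙-cancelʳ (rest c n) (a 0 * b n) (a 0 * c n)
                                (trans (cong (λ s → a 0 * b n + s) (sym (rest-cong n rec))) (ab≈ac n))) ⟩
  1/ a 0 * (a 0 * c n)     ≡⟨ sym (unscale (c n)) ⟩
  c n                      ∎
  where
  open GroupProperties +-group using (∙-cancelʳ)
  rest : PowerSeries → ℕ → ℚ
  rest b n = sum {n} λ k → a (suc (toℕ k)) * b (n ∸ suc (toℕ k))
  rest-cong : ∀ n → (∀ {m} → m ℕ.< n → b m ≡ c m) → rest b n ≡ rest c n
  rest-cong n rec = sum-cong-≗ {n} λ k →
    cong (a (suc (toℕ k)) *_) (rec (ℕ.∸-monoʳ-< {n} {suc (toℕ k)} {0} (s≤s z≤n) (toℕ<n k)))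
  unscale : ∀ x → x ≡ 1/ a 0 * (a 0 * x)
  unscale x = sym (trans (sym (ℚ.*-assoc (1/ a 0) (a 0) x))
                (trans (cong (_* x) (ℚ.*-inverseˡ (a 0))) (ℚ.*-identityˡ x)))

f-suc-suc : ∀ k → f (suc (suc k)) ≡ f k
f-suc-suc k = cong (if_then 1ℚ else 0ℚ)
  (does-⇔ (mk⇔ (λ 2∣2+k → ∣m+n∣m⇒∣n 2∣2+k ∣-refl) (∣m∣n⇒∣m+n ∣-refl))
    (2 ∣? suc (suc k)) (2 ∣? k))

-- Both sides have period two in `k`.
1^k+[-1]^k≡2f : ∀ k → 1ℚ ^ k + (- 1ℚ) ^ k ≡ f k + f k
1^k+[-1]^k≡2f zero          = refl
1^k+[-1]^k≡2f (suc zero)    = refl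
1^k+[-1]^k≡2f (suc (suc k)) = begin
  1ℚ * (1ℚ * 1ℚ ^ k) + - 1ℚ * (- 1ℚ * (- 1ℚ) ^ k)
    ≡⟨ solve 2 (λ x y → con 1ℚ :* (con 1ℚ :* x) :+ con (- 1ℚ) :* (con (- 1ℚ) :* y) := x :+ y) refl
         (1ℚ ^ k) ((- 1ℚ) ^ k) ⟩
  1ℚ ^ k + (- 1ℚ) ^ k
    ≡⟨ 1^k+[-1]^k≡2f k ⟩
  f k + f k
    ≡⟨ sym (cong₂ _+_ (f-suc-suc k) (f-suc-suc k)) ⟩
  f (suc (suc k)) + f (suc (suc k)) ∎

-- The prescribed constant term fits the general formula, since the empty word is the one
-- derangement of the empty set.
D-egf : ∀ t n → D t n ≡ Dₙ n t * 1/! n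
D-egf t zero    = refl
D-egf t (suc n) = refl

p+p≡0⇒p≡0 : ∀ p → p + p ≡ 0ℚ → p ≡ 0ℚ
p+p≡0⇒p≡0 p eq = begin
  p            ≡⟨ solve 1 (λ p → p := con ½ :* (p :+ p)) refl p ⟩
  ½ * (p + p)  ≡⟨ q≡0⇒p*q≡0 ½ eq ⟩
  0ℚ           ∎

F⊛D≈one : F ⊛ D (- 1ℚ) ≈ one
F⊛D≈one zero    = refl
-- Doubling the coefficient lets `f k + f k` be replaced by a sum of two powers.
F⊛D≈one (suc n) = p+p≡0⇒p≡0 _ (begin
  sum {suc N} coeff + sum {suc N} coeff
    ≡⟨ sym (∑-distrib-+ {suc N} coeff coeff) ⟩
  sum {suc N} (λ k → coeff k + coeff k)
    ≡⟨ sum-cong-≗ {suc N} double ⟩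
  sum {suc N} (λ k → 1/! N * (term 1ℚ k + term (- 1ℚ) k))
    ≡⟨ sym (*-distribˡ-sum {suc N} (1/! N) λ k → term 1ℚ k + term (- 1ℚ) k) ⟩
  1/! N * sum {suc N} (λ k → term 1ℚ k + term (- 1ℚ) k)
    ≡⟨ cong (1/! N *_) (∑-distrib-+ {suc N} (term 1ℚ) (term (- 1ℚ))) ⟩
  1/! N * (sum {suc N} (term 1ℚ) + sum {suc N} (term (- 1ℚ)))
    ≡⟨ cong (1/! N *_) (sym (cong₂ _+_ (per-excMatrix-binomial (- 1ℚ) 1ℚ N)
         (per-excMatrix-binomial (- 1ℚ) (- 1ℚ) N))) ⟩
  1/! N * (P 1ℚ + P (- 1ℚ))
    -- At `t = -1` the diagonal `t` is the diagonal -1, so rotation gives `P (- 1ℚ) ≡ - 1ℚ * P 1ℚ`;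
    -- the size `N` is positive here.
    ≡⟨ cong (λ p → 1/! N * (P 1ℚ + p)) (per-excMatrix-rotate (- 1ℚ) n) ⟩
  1/! N * (P 1ℚ + - 1ℚ * P 1ℚ)
    ≡⟨ solve 2 (λ r p → r :* (p :+ con (- 1ℚ) :* p) := con 0ℚ) refl (1/! N) (P 1ℚ) ⟩
  0ℚ ∎)
  where
  N : ℕ
  N = suc n
  P : ℚ → ℚ
  P y = per {N} {N} (excMatrix (- 1ℚ) (const y))
  coeff : Fin (suc N) → ℚ
  coeff k = F (toℕ k) * D (- 1ℚ) (N ∸ toℕ k)
  term : ℚ → Fin (suc N) → ℚ
  term y k = (N C toℕ k) × 1ℚ * y ^ toℕ k * Dₙ (N ∸ toℕ k) (- 1ℚ)
  double : ∀ k → coeff k + coeff k ≡ 1/! N * (term 1ℚ k + term (- 1ℚ) k)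
  double k = begin
    coeff k + coeff k
      ≡⟨ cong (λ x → F i * x + F i * x) (D-egf (- 1ℚ) (N ∸ i)) ⟩
    f i * 1/! i * (d * 1/! (N ∸ i)) + f i * 1/! i * (d * 1/! (N ∸ i))
      ≡⟨ solve 4 (λ f r d s → f :* r :* (d :* s) :+ f :* r :* (d :* s) := (r :* s) :* ((f :+ f) :* d)) refl
           (f i) (1/! i) d (1/! (N ∸ i)) ⟩
    1/! i * 1/! (N ∸ i) * ((f i + f i) * d)
      ≡⟨ cong₂ (λ x y → x * (y * d)) (sym (C-*-1/! (ℕ.≤-pred (toℕ<n k)))) (sym (1^k+[-1]^k≡2f i)) ⟩
    c * 1/! N * ((1ℚ ^ i + (- 1ℚ) ^ i) * d)
      ≡⟨ solve 5 (λ c r x y d → c :* r :* ((x :+ y) :* d) := r :* (c :* x :* d :+ c :* y :* d)) refl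
           c (1/! N) (1ℚ ^ i) ((- 1ℚ) ^ i) d ⟩
    1/! N * (term 1ℚ k + term (- 1ℚ) k) ∎
    where
    i : ℕ
    i = toℕ k
    c d : ℚ
    c = (N C i) × 1ℚ
    d = Dₙ (N ∸ i) (- 1ℚ)

corollary10 : D (- 1ℚ) ≈ F ⁻¹
-- Both series have product `one` with `F`, which can be cancelled.
corollary10 = ⊛-cancelˡ F λ n → trans (F⊛D≈one n) (sym (⊛-inverseʳ F n))
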